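{- Let $N\ge1$, let $\phi:H_0(S_N)\to M_N$ be the quotient morphism sending $\pi_i\mapsto \pi_i$, where $M_N$ is the quotient of $H_0(S_N)$ by the relations $\pi_i\pi_{i+1}\pi_i=\pi_i\pi_{i+1}$ ($1\le i\le N-2$), let $\Psi$ be the automorphism of $H_0(S_N)$ with $\Psi(\pi_i)=\pi_{N-i}$, and define $\omega(x)=(\phi(x),\phi(\Psi(x)))$ for $x\in H_0(S_N)$. Then every nonempty fiber $\{w\in S_N:\ \omega(\pi_w)=c\}$ of $\omega$ contains a unique $[4321]$-avoiding permutation.
   Context: $S_N$ is generated by simple transpositions $s_1,\dots,s_{N-1}$; permutations are in one-line notation and composed as functions. $H_0(S_N)$ is generated by $\pi_1,\dots,\pi_{N-1}$ with relations $\pi_i^2=\pi_i$, $\pi_i\pi_j=\pi_j\pi_i$ for $|i-j|\ge2$, $\pi_i\pi_{i+1}\pi_i=\pi_{i+1}\pi_i\pi_{i+1}$; $\pi_w:=\pi_{i_1}\cdots\pi_{i_k}$ for any reduced word $w=s_{i_1}\cdots s_{i_k}$, a bijection $S_N\to H_0(S_N)$. A permutation avoids $[4321]$ if its one-line notation has no decreasing subsequence of length $4$. ($M_N$ is isomorphic to the monoid $\operatorname{NDPF}_N$ of order-preserving regressive maps of $\{1,\dots,N\}$.) -}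

module Defs where

open import Algebra.Bundles using (Monoid)
open import Algebra.Construct.DirectProduct using () renaming (monoid to _×ᴹ_)
open import Algebra.Morphism.Structures using (module MonoidMorphisms)
open import Data.Fin using (Fin; toℕ; inject₁; suc; opposite; _<_)
open import Data.Fin.Permutation
  using (Permutation′; _⟨$⟩ʳ_; _∘ₚ_; transpose; id; _≈_)
open import Data.Fin.Properties using (opposite-prop; opposite-involutive; toℕ<n)
open import Data.List using (List; []; _∷_; _++_; map; foldr; length)
open import Data.List.Properties using (++-monoid; map-++; map-∘; map-id; map-cong)
open import Data.Nat as ℕ using (ℕ; ∣_-_∣)
import Data.Nat.Properties as ℕₚ
open import Data.Product using (∃; _×_; _,_; proj₁; proj₂)
open import Function using (_∘_)
open import Level using (Level; 0ℓ; _⊔_)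
open import Relation.Binary.Core using (Rel)
open import Relation.Binary.PropositionalEquality
  using (_≡_; refl; sym; trans; cong; cong₂; subst₂; module ≡-Reasoning)
open import Relation.Nullary using (¬_)

------------------------------------------------------------------------
-- Quotient of a monoid by the congruence generated by a relation

module _ {c ℓ r : Level} (M : Monoid c ℓ) where
  private module M = Monoid M

  data Congruence (R : Rel M.Carrier r) : Rel M.Carrier (c ⊔ ℓ ⊔ r) where
    rel    : ∀ {x y} → R x y → Congruence R x y
    equal  : ∀ {x y} → x M.≈ y → Congruence R x y
    symm   : ∀ {x y} → Congruence R x y → Congruence R y x
    tran   : ∀ {x y z} → Congruence R x y → Congruence R y z → Congruence R x z
    ∙-cong : ∀ {x x′ y y′} → Congruence R x x′ → Congruence R y y′ →
             Congruence R (x M.∙ y) (x′ M.∙ y′)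

  infixl 5 _/ᴹ_

  _/ᴹ_ : Rel M.Carrier r → Monoid c (c ⊔ ℓ ⊔ r)
  _/ᴹ_ R = record
    { Carrier  = M.Carrier
    ; _≈_      = Congruence R
    ; _∙_      = M._∙_
    ; ε        = M.ε
    ; isMonoid = record
      { isSemigroup = record
        { isMagma = record
          { isEquivalence = record { refl = equal M.refl ; sym = symm ; trans = tran }
          ; ∙-cong        = ∙-cong
          }
        ; assoc = λ x y z → equal (M.assoc x y z)
        }
      ; identity = (λ x → equal (M.identityˡ x)) , (λ x → equal (M.identityʳ x))
      }
    }

------------------------------------------------------------------------
-- Throughout, N = 1 + n.  The generator index i : Fin n stands for the
-- 1-based index 1 + toℕ i ∈ {1, …, N-1}.

Word : ℕ → Set
Word n = List (Fin n)

data HeckeRelation (n : ℕ) : Rel (Word n) 0ℓ where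
  idem  : ∀ i → HeckeRelation n (i ∷ i ∷ []) (i ∷ [])
  comm  : ∀ i j → 2 ℕ.≤ ∣ toℕ i - toℕ j ∣ →
          HeckeRelation n (i ∷ j ∷ []) (j ∷ i ∷ [])
  braid : ∀ i j → toℕ j ≡ ℕ.suc (toℕ i) →
          HeckeRelation n (i ∷ j ∷ i ∷ []) (j ∷ i ∷ j ∷ [])

-- H₀(S_N): its elements are words, π_i being the one-letter word i.
H₀ : ℕ → Monoid 0ℓ 0ℓ
H₀ n = ++-monoid (Fin n) /ᴹ HeckeRelation n

data NDPFRelation (n : ℕ) : Rel (Monoid.Carrier (H₀ n)) 0ℓ where
  ndpf : ∀ i j → toℕ j ≡ ℕ.suc (toℕ i) →
         NDPFRelation n (i ∷ j ∷ i ∷ []) (i ∷ j ∷ [])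

-- M_N
M : ℕ → Monoid 0ℓ 0ℓ
M n = H₀ n /ᴹ NDPFRelation n

-- Both monoids have words as carrier, so the quotient map is the identity
-- on representatives.
φ : ∀ {n} → Monoid.Carrier (H₀ n) → Monoid.Carrier (M n)
φ x = x

-- π_i ↦ π_{N-i}: since toℕ (opposite i) = n - 1 - toℕ i, the 1-based index
-- of opposite i is N minus that of i.
Ψ : ∀ {n} → Monoid.Carrier (H₀ n) → Monoid.Carrier (H₀ n)
Ψ = map opposite

ω : ∀ {n} → Monoid.Carrier (H₀ n) → Monoid.Carrier (M n ×ᴹ M n)
ω x = φ x , φ (Ψ x)

------------------------------------------------------------------------
-- Permutations

s : ∀ {n} → Fin n → Permutation′ (ℕ.suc n)
s i = transpose (inject₁ i) (suc i)

-- s_{i₁} ∘ ⋯ ∘ s_{iₖ} as functions; note that σ ∘ₚ τ applies σ first.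
product : ∀ {n} → Word n → Permutation′ (ℕ.suc n)
product = foldr (λ i σ → σ ∘ₚ s i) id

IsReducedWord : ∀ {n} → Permutation′ (ℕ.suc n) → Word n → Set
IsReducedWord w u =
  product u ≈ w × (∀ v → product v ≈ w → length u ℕ.≤ length v)

-- x = π_w, i.e. x = π_{i₁} ⋯ π_{iₖ} in H₀ for a reduced word i₁ ⋯ iₖ of w.
_IsPi_ : ∀ {n} → Monoid.Carrier (H₀ n) → Permutation′ (ℕ.suc n) → Set
_IsPi_ {n} x w = ∃ λ u → IsReducedWord w u × Monoid._≈_ (H₀ n) x u

-- w lies in the fiber over c, i.e. ω(π_w) = c.
InFiber : ∀ {n} → Monoid.Carrier (M n ×ᴹ M n) → Permutation′ (ℕ.suc n) → Set
InFiber {n} c w = ∃ λ x → x IsPi w × Monoid._≈_ (M n ×ᴹ M n) (ω x) c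

Avoids4321 : ∀ {N} → Permutation′ N → Set
Avoids4321 w = ¬ (∃ λ a → ∃ λ b → ∃ λ c → ∃ λ d →
  (a < b × b < c × c < d) ×
  ((w ⟨$⟩ʳ d) < (w ⟨$⟩ʳ c) × (w ⟨$⟩ʳ c) < (w ⟨$⟩ʳ b) × (w ⟨$⟩ʳ b) < (w ⟨$⟩ʳ a)))

------------------------------------------------------------------------
-- φ is a surjective homomorphism and Ψ an automorphism

module _ {n : ℕ} where
  private
    module H = Monoid (H₀ n)
    module Q = Monoid (M n)
    module Φ = MonoidMorphisms H.rawMonoid Q.rawMonoid
    module Ψ′ = MonoidMorphisms H.rawMonoid H.rawMonoid

    opposite-sum : (i : Fin n) → toℕ (opposite i) ℕ.+ ℕ.suc (toℕ i) ≡ n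
    opposite-sum i =
      trans (cong (ℕ._+ ℕ.suc (toℕ i)) (opposite-prop i)) (ℕₚ.m∸n+n≡m (toℕ<n i))

    opposite-suc′ : (i j : Fin n) → toℕ j ≡ ℕ.suc (toℕ i) →
                    toℕ (opposite i) ≡ ℕ.suc (toℕ (opposite j))
    opposite-suc′ i j j≡1+i = ℕₚ.+-cancelʳ-≡ (ℕ.suc (toℕ i)) _ _ (begin
      toℕ (opposite i) ℕ.+ ℕ.suc (toℕ i)           ≡⟨ opposite-sum i ⟩
      n                                            ≡⟨ opposite-sum j ⟨
      toℕ (opposite j) ℕ.+ ℕ.suc (toℕ j)           ≡⟨ ℕₚ.+-suc _ _ ⟩
      ℕ.suc (toℕ (opposite j)) ℕ.+ toℕ j           ≡⟨ cong (ℕ.suc (toℕ (opposite j)) ℕ.+_) j≡1+i ⟩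
      ℕ.suc (toℕ (opposite j)) ℕ.+ ℕ.suc (toℕ i)   ∎)
      where open ≡-Reasoning

    dist : ∀ a b c d → a ℕ.+ c ≡ b ℕ.+ d → ∣ c - d ∣ ≡ ∣ a - b ∣
    dist a b c d e = begin
      ∣ c - d ∣                         ≡⟨ ℕₚ.∣m+n-m+o∣≡∣n-o∣ a c d ⟨
      ∣ a ℕ.+ c - a ℕ.+ d ∣             ≡⟨ cong (λ z → ∣ z - a ℕ.+ d ∣) e ⟩
      ∣ b ℕ.+ d - a ℕ.+ d ∣             ≡⟨ cong₂ ∣_-_∣ (ℕₚ.+-comm b d) (ℕₚ.+-comm a d) ⟩
      ∣ d ℕ.+ b - d ℕ.+ a ∣             ≡⟨ ℕₚ.∣m+n-m+o∣≡∣n-o∣ d b a ⟩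
      ∣ b - a ∣                         ≡⟨ ℕₚ.∣-∣-comm b a ⟩
      ∣ a - b ∣                         ∎
      where open ≡-Reasoning

    opposite-dist : (i j : Fin n) →
                    ∣ toℕ i - toℕ j ∣ ≡ ∣ toℕ (opposite i) - toℕ (opposite j) ∣
    opposite-dist i j = dist _ _ (ℕ.suc (toℕ i)) (ℕ.suc (toℕ j))
      (trans (opposite-sum i) (sym (opposite-sum j)))

    Ψ-rel : ∀ {x y} → HeckeRelation n x y → Ψ x H.≈ Ψ y
    Ψ-rel (idem i)          = rel (idem _)
    Ψ-rel (comm i j 2≤)     = rel (comm _ _ (subst₂ ℕ._≤_ refl (opposite-dist i j) 2≤))
    Ψ-rel (braid i j j≡1+i) = symm (rel (braid _ _ (opposite-suc′ i j j≡1+i)))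

    Ψ-++ : ∀ x y → Ψ (x ++ y) H.≈ Ψ x ++ Ψ y
    Ψ-++ x y = equal (map-++ opposite x y)

    Ψ-cong : ∀ {x y} → x H.≈ y → Ψ x H.≈ Ψ y
    Ψ-cong (rel p)    = Ψ-rel p
    Ψ-cong (equal p)  = equal (cong Ψ p)
    Ψ-cong (symm p)   = symm (Ψ-cong p)
    Ψ-cong (tran p q) = tran (Ψ-cong p) (Ψ-cong q)
    Ψ-cong (∙-cong {x} {x′} {y} {y′} p q) =
      tran (Ψ-++ x y) (tran (∙-cong (Ψ-cong p) (Ψ-cong q)) (symm (Ψ-++ x′ y′)))

    Ψ-involutive : (x : Word n) → Ψ (Ψ x) ≡ x
    Ψ-involutive x =
      trans (sym (map-∘ x)) (trans (map-cong opposite-involutive x) (map-id x))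

  φ-isMonoidHomomorphism : Φ.IsMonoidHomomorphism φ
  φ-isMonoidHomomorphism = record
    { isMagmaHomomorphism = record
      { isRelHomomorphism = record { cong = equal }
      ; homo              = λ x y → Q.refl
      }
    ; ε-homo = Q.refl
    }

  φ-surjective : ∀ y → ∃ λ x → φ x Q.≈ y
  φ-surjective y = y , Q.refl

  Ψ-isMonoidIsomorphism : Ψ′.IsMonoidIsomorphism Ψ
  Ψ-isMonoidIsomorphism = record
    { isMonoidMonomorphism = record
      { isMonoidHomomorphism = record
        { isMagmaHomomorphism = record
          { isRelHomomorphism = record { cong = Ψ-cong }
          ; homo              = Ψ-++
          }
        ; ε-homo = H.refl
        }
      ; injective = λ {x} {y} p →
          subst₂ H._≈_ (Ψ-involutive x) (Ψ-involutive y) (Ψ-cong p)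
      }
    ; surjective = λ y → Ψ y , λ {z} z≈Ψy →
        H.trans (Ψ-cong z≈Ψy) (equal (Ψ-involutive y))
    }

{-# OPTIONS --safe #-}
module Submission where

-- M_N acts faithfully on {1, …, N} by π_i : i+1 ↦ i, and there φ(π_w) is the
-- map j ↦ min {w(r) | r ≥ j}; dually φ(Ψ(π_w)) records the maxima of w over
-- prefixes.  Two values of w which play the roles of 3 and 2 in a 4321 pattern
-- attain none of these extrema, so exchanging them shortens w within its fiber;
-- hence each fiber contains an avoiding permutation.  Conversely, if two
-- permutations of a fiber first differ at position p, the one with the larger
-- value at p contains 4321, with that value as the 3.

open import Defs
open import Algebra.Bundles using (Monoid)
open import Algebra.Construct.DirectProduct using () renaming (monoid to _×ᴹ_)
open import Algebra.Morphism.Structures using (module MonoidMorphisms)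
open import Data.Empty using (⊥-elim)
open import Data.Fin as Fin using (Fin; toℕ; fromℕ<; inject₁; opposite)
open import Data.Fin.Induction using () renaming (<-wellFounded to Fin-<-wellFounded)
open import Data.Fin.Permutation using (Permutation′; _≈_; _⟨$⟩ʳ_; _⟨$⟩ˡ_; inverseˡ; inverseʳ)
open import Data.Fin.Permutation.Components using (transpose; transpose-inverse)
import Data.Fin.Properties as Finₚ
open import Data.List using ([]; _∷_; _++_; length)
open import Data.Nat using (ℕ; zero; suc; _+_; _≤_; _<_; _∸_; z≤n; s≤s; s≤s⁻¹; ∣_-_∣)
open import Data.Nat.Induction using (<-wellFounded)
open import Data.Nat.Properties
open import Data.Product using (∃; ∃!; _×_; _,_; proj₁; proj₂)
open import Data.Sum using (_⊎_; inj₁; inj₂)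
open import Function using (_∘_)
open import Function.Definitions using (Injective)
open import Induction.WellFounded using (Acc; acc)
open import Relation.Binary using (tri<; tri≈; tri>)
open import Relation.Binary.PropositionalEquality
  using (_≡_; _≢_; _≗_; refl; sym; trans; cong; subst; subst₂)
open import Relation.Nullary using (Dec; yes; no)
open import Relation.Nullary.Decidable using (_×-dec_)

-- Order-preserving regressive maps and their normal forms

opaque
  -- The action of the generator with 0-based index `i` on values counted from 0. Being opaque, it
  -- is accessible later only through the lemmas of this block.
  collapse : ℕ → ℕ → ℕ
  collapse i k with k ≟ suc i
  ... | yes _ = i
  ... | no  _ = k

  collapse-suc : ∀ i → collapse i (suc i) ≡ i
  collapse-suc i with suc i ≟ suc i
  ... | yes _ = refl
  ... | no ≢  = ⊥-elim (≢ refl)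

  collapse-other : ∀ {i k} → k ≢ suc i → collapse i k ≡ k
  collapse-other {i} {k} ≢ with k ≟ suc i
  ... | yes ≡ = ⊥-elim (≢ ≡)
  ... | no  _ = refl

  collapse-≤ : ∀ i k → collapse i k ≤ k
  collapse-≤ i k with k ≟ suc i
  ... | yes refl = n≤1+n i
  ... | no  _    = ≤-refl

  collapse-mono : ∀ i {k l} → k ≤ l → collapse i k ≤ collapse i l
  collapse-mono i {k} {l} k≤l with k ≟ suc i | l ≟ suc i
  ... | yes refl | yes refl = ≤-refl
  ... | yes refl | no  _    = ≤-trans (n≤1+n i) k≤l
  ... | no  k≢   | yes refl = s≤s⁻¹ (≤∧≢⇒< k≤l k≢)
  ... | no  _    | no  _    = k≤l

record NDPF (f : ℕ → ℕ) : Set where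
  field
    regressive : ∀ k → f k ≤ k
    monotone   : ∀ {k l} → k ≤ l → f k ≤ f l

collapse-NDPF : ∀ i {f} → NDPF f → NDPF (collapse i ∘ f)
collapse-NDPF i F = record
  { regressive = λ k → ≤-trans (collapse-≤ i _) (regressive k)
  ; monotone   = λ k≤l → collapse-mono i (monotone k≤l)
  }
  where open NDPF F

-- The relations of `M n`, with indices running through all of ℕ. The two absorption laws stand for
-- the braid and the NDPF relation together: both sides of the braid relation equal
-- `g i ∙ g (suc i)`.
record Generators {c ℓ} (X : Monoid c ℓ) (g : ℕ → Monoid.Carrier X) : Set ℓ where
  open Monoid X using (_∙_) renaming (_≈_ to _∼_)
  field
    idempotent : ∀ i → g i ∙ g i ∼ g i
    commute    : ∀ i j → 2 + i ≤ j → g i ∙ g j ∼ g j ∙ g i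
    absorbˡ    : ∀ i → g (suc i) ∙ (g i ∙ g (suc i)) ∼ g i ∙ g (suc i)
    absorbʳ    : ∀ i → g i ∙ (g (suc i) ∙ g i) ∼ g i ∙ g (suc i)

module NormalForm {c ℓ} (X : Monoid c ℓ) (g : ℕ → Monoid.Carrier X) (G : Generators X g) where
  open Monoid X renaming (_≈_ to _∼_; ∙-cong to ∙-cong₂; refl to ∼-refl; sym to ∼-sym; trans to ∼-trans)
  open Generators G
  open import Relation.Binary.Reasoning.Setoid setoid

  -- g a ∙ g (a + 1) ∙ ⋯ ∙ g (a + l - 1), which maps the interval [a , a + l] to a.
  run : ℕ → ℕ → Carrier
  run a zero    = ε
  run a (suc l) = g a ∙ run (suc a) l

  commute-run : ∀ i a l → 2 + i ≤ a → g i ∙ run a l ∼ run a l ∙ g i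
  commute-run i a zero    _    = ∼-trans (identityʳ _) (∼-sym (identityˡ _))
  commute-run i a (suc l) 2+i≤ = begin
    g i ∙ (g a ∙ run (suc a) l)  ≈⟨ assoc _ _ _ ⟨
    g i ∙ g a ∙ run (suc a) l    ≈⟨ ∙-congʳ (commute i a 2+i≤) ⟩
    g a ∙ g i ∙ run (suc a) l    ≈⟨ assoc _ _ _ ⟩
    g a ∙ (g i ∙ run (suc a) l)  ≈⟨ ∙-congˡ (commute-run i (suc a) l (m≤n⇒m≤1+n 2+i≤)) ⟩
    g a ∙ (run (suc a) l ∙ g i)  ≈⟨ assoc _ _ _ ⟨
    g a ∙ run (suc a) l ∙ g i    ∎

  -- As a map the run never takes the value `i + 1`, so a subsequent `g i` does nothing. In the
  -- monoid, `g i` commutes past the letters below `i - 1` and is then absorbed by `absorbˡ`, or by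
  -- idempotence if the run starts with `g i`.
  absorb-run : ∀ i a l → a ≤ i → i < a + l → g i ∙ run a l ∼ run a l
  absorb-run i a zero a≤i i<a = ⊥-elim (<⇒≱ (subst (i <_) (+-identityʳ a) i<a) a≤i)
  absorb-run i a (suc l) a≤i i<a+ with m≤n⇒m<n∨m≡n a≤i
  ... | inj₂ refl = begin
    g i ∙ (g i ∙ run (suc i) l)  ≈⟨ assoc _ _ _ ⟨
    g i ∙ g i ∙ run (suc i) l    ≈⟨ ∙-congʳ (idempotent i) ⟩
    g i ∙ run (suc i) l          ∎
  ... | inj₁ a<i with m≤n⇒m<n∨m≡n a<i
  ...   | inj₁ 1+a<i = begin
    g i ∙ (g a ∙ run (suc a) l)  ≈⟨ assoc _ _ _ ⟨
    g i ∙ g a ∙ run (suc a) l    ≈⟨ ∙-congʳ (commute a i 1+a<i) ⟨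
    g a ∙ g i ∙ run (suc a) l    ≈⟨ assoc _ _ _ ⟩
    g a ∙ (g i ∙ run (suc a) l)  ≈⟨ ∙-congˡ (absorb-run i (suc a) l a<i (subst (i <_) (+-suc a l) i<a+)) ⟩
    g a ∙ run (suc a) l          ∎
  absorb-run i a (suc zero) a≤i i<a+ | inj₁ a<i | inj₂ refl =
    ⊥-elim (<-irrefl (+-comm 1 a) i<a+)
  absorb-run i a (suc (suc l)) a≤i i<a+ | inj₁ a<i | inj₂ refl = begin
    g i ∙ (g a ∙ (g i ∙ r))  ≈⟨ ∙-congˡ (assoc _ _ _) ⟨
    g i ∙ (g a ∙ g i ∙ r)    ≈⟨ assoc _ _ _ ⟨
    g i ∙ (g a ∙ g i) ∙ r    ≈⟨ ∙-congʳ (absorbˡ a) ⟩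
    g a ∙ g i ∙ r            ≈⟨ assoc _ _ _ ⟩
    g a ∙ (g i ∙ r)          ∎
    where r = run (suc i) l

  -- As a map, `g a` merges two points that the run merges anyway. In the monoid it commutes past
  -- all letters after the first two, where `absorbʳ` applies.
  run-absorb : ∀ a l → run a (2 + l) ∙ g a ∼ run a (2 + l)
  run-absorb a l = begin
    (g a ∙ (g (suc a) ∙ r)) ∙ g a  ≈⟨ assoc _ _ _ ⟩
    g a ∙ ((g (suc a) ∙ r) ∙ g a)  ≈⟨ ∙-congˡ (assoc _ _ _) ⟩
    g a ∙ (g (suc a) ∙ (r ∙ g a))  ≈⟨ ∙-congˡ (∙-congˡ (commute-run a (2 + a) l ≤-refl)) ⟨
    g a ∙ (g (suc a) ∙ (g a ∙ r))  ≈⟨ ∙-congˡ (assoc _ _ _) ⟨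
    g a ∙ (g (suc a) ∙ g a ∙ r)    ≈⟨ assoc _ _ _ ⟨
    g a ∙ (g (suc a) ∙ g a) ∙ r    ≈⟨ ∙-congʳ (absorbʳ a) ⟩
    g a ∙ g (suc a) ∙ r            ≈⟨ assoc _ _ _ ⟩
    g a ∙ (g (suc a) ∙ r)          ∎
    where r = run (2 + a) l

  runTo : ℕ → ℕ → Carrier
  runTo a k = run a (k ∸ a)

  -- The runs send each k to f k; the ones for small k act first.
  nf : ℕ → (ℕ → ℕ) → Carrier
  nf zero    f = ε
  nf (suc k) f = runTo (f (suc k)) (suc k) ∙ nf k f

  nf-cong : ∀ k {f f′} → (∀ j → j ≤ k → f j ≡ f′ j) → nf k f ∼ nf k f′
  nf-cong zero    e = ∼-refl
  nf-cong (suc k) e = ∙-cong₂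
    (reflexive (cong (λ a → runTo a (suc k)) (e (suc k) ≤-refl)))
    (nf-cong k (λ j j≤k → e j (m≤n⇒m≤1+n j≤k)))

  nf-id : ∀ k → nf k (λ j → j) ∼ ε
  nf-id zero    = ∼-refl
  nf-id (suc k) = begin
    runTo (suc k) (suc k) ∙ nf k (λ j → j)  ≈⟨ ∙-congʳ (reflexive (cong (run (suc k)) (n∸n≡0 k))) ⟩
    ε ∙ nf k (λ j → j)                      ≈⟨ identityˡ _ ⟩
    nf k (λ j → j)                          ≈⟨ nf-id k ⟩
    ε                                       ∎

  runTo-step : ∀ {a k} → a ≤ k → runTo a (suc k) ∼ g a ∙ runTo (suc a) (suc k)
  runTo-step {a} a≤k = reflexive (cong (run a) (+-∸-assoc 1 a≤k))

  runTo-absorb : ∀ {a k} → a < k → runTo a (suc k) ∙ g a ∼ runTo a (suc k)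
  runTo-absorb {a} {suc k} (s≤s a≤k) rewrite +-∸-assoc 2 a≤k = run-absorb a (k ∸ a)

  -- The leading run ends at `a = f (suc k)`, the largest value of `f` up to `suc k`. If
  -- `i + 1 < a`, then `g i` commutes past the run. If `i + 1 > a`, the run absorbs `g i`, and
  -- `collapse i` fixes all values concerned. If `i + 1 = a`, then `g i` extends the run, which can
  -- emit a copy of `g i` on its right for the recursion.
  nf-collapse : ∀ k i {f} → NDPF f → i < k → g i ∙ nf k f ∼ nf k (collapse i ∘ f)
  nf-collapse (suc k) i {f} F i<1+k with <-cmp (suc i) (f (suc k))
  ... | tri< 1+i<a 1+i≢a _ = begin
    g i ∙ (runTo a (suc k) ∙ nf k f)  ≈⟨ assoc _ _ _ ⟨
    g i ∙ runTo a (suc k) ∙ nf k f    ≈⟨ ∙-congʳ (commute-run i a (suc k ∸ a) 1+i<a) ⟩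
    runTo a (suc k) ∙ g i ∙ nf k f    ≈⟨ assoc _ _ _ ⟩
    runTo a (suc k) ∙ (g i ∙ nf k f)  ≈⟨ ∙-cong₂
      (reflexive (cong (λ b → runTo b (suc k)) (sym (collapse-other (1+i≢a ∘ sym)))))
      (nf-collapse k i F (s≤s⁻¹ (≤-trans 1+i<a (NDPF.regressive F (suc k))))) ⟩
    nf (suc k) (collapse i ∘ f)       ∎
    where a = f (suc k)
  ... | tri> _ 1+i≢a a<1+i = begin
    g i ∙ (runTo a (suc k) ∙ nf k f)  ≈⟨ assoc _ _ _ ⟨
    g i ∙ runTo a (suc k) ∙ nf k f    ≈⟨ ∙-congʳ (absorb-run i a (suc k ∸ a) (s≤s⁻¹ a<1+i)
      (subst (i <_) (sym (m+[n∸m]≡n (NDPF.regressive F (suc k)))) i<1+k)) ⟩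
    runTo a (suc k) ∙ nf k f          ≈⟨ nf-cong (suc k) (λ j j≤1+k → sym (collapse-other
      (<⇒≢ (≤-<-trans (NDPF.monotone F j≤1+k) a<1+i)))) ⟩
    nf (suc k) (collapse i ∘ f)       ∎
    where a = f (suc k)
  ... | tri≈ _ 1+i≡a _ = begin
    g i ∙ (runTo a (suc k) ∙ nf k f)             ≈⟨ assoc _ _ _ ⟨
    g i ∙ runTo a (suc k) ∙ nf k f               ≈⟨ ∙-congʳ (∙-congˡ
      (reflexive (cong (λ b → runTo b (suc k)) 1+i≡a))) ⟨
    g i ∙ runTo (suc i) (suc k) ∙ nf k f         ≈⟨ ∙-congʳ (runTo-step (s≤s⁻¹ i<1+k)) ⟨
    runTo i (suc k) ∙ nf k f                     ≈⟨ absorbed (m≤n⇒m<n∨m≡n (s≤s⁻¹ i<1+k)) ⟩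
    runTo i (suc k) ∙ nf k (collapse i ∘ f)      ≈⟨ ∙-congʳ (reflexive (cong (λ b → runTo b (suc k)) new)) ⟨
    nf (suc k) (collapse i ∘ f)                  ∎
    where
    a = f (suc k)
    new : collapse i a ≡ i
    new = trans (cong (collapse i) (sym 1+i≡a)) (collapse-suc i)
    absorbed : i < k ⊎ i ≡ k → runTo i (suc k) ∙ nf k f ∼ runTo i (suc k) ∙ nf k (collapse i ∘ f)
    absorbed (inj₁ i<k) = begin
      runTo i (suc k) ∙ nf k f            ≈⟨ ∙-congʳ (runTo-absorb i<k) ⟨
      runTo i (suc k) ∙ g i ∙ nf k f      ≈⟨ assoc _ _ _ ⟩
      runTo i (suc k) ∙ (g i ∙ nf k f)    ≈⟨ ∙-congˡ (nf-collapse k i F i<k) ⟩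
      runTo i (suc k) ∙ nf k (collapse i ∘ f)  ∎
    -- The recursion would need `i < k`; here instead `f j ≤ j ≤ i`, so `collapse i` fixes every
    -- remaining value.
    absorbed (inj₂ i≡k) = ∙-congˡ (nf-cong k (λ j j≤k → sym (collapse-other
      (<⇒≢ (s≤s (≤-trans (NDPF.regressive F j) (subst (j ≤_) (sym i≡k) j≤k)))))))

-- The action of words and its faithfulness on `M n`

act : ∀ {n} → Word n → ℕ → ℕ
act []      k = k
act (i ∷ u) k = collapse (toℕ i) (act u k)

act-NDPF : ∀ {n} (u : Word n) → NDPF (act u)
act-NDPF []      = record { regressive = λ _ → ≤-refl ; monotone = λ k≤l → k≤l }
act-NDPF (i ∷ u) = collapse-NDPF (toℕ i) (act-NDPF u)

act-++ : ∀ {n} (u v : Word n) → act (u ++ v) ≗ act u ∘ act v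
act-++ []      v k = refl
act-++ (i ∷ u) v k = cong (collapse (toℕ i)) (act-++ u v k)

collapse-idem : ∀ i k → collapse i (collapse i k) ≡ collapse i k
collapse-idem i k with k ≟ suc i
... | yes refl rewrite collapse-suc i = collapse-other (<⇒≢ (n<1+n i))
... | no  k≢   rewrite collapse-other k≢ = collapse-other k≢

collapse-comm : ∀ i j k → 2 + i ≤ j → collapse i (collapse j k) ≡ collapse j (collapse i k)
collapse-comm i j k 2+i≤j with k ≟ suc j | k ≟ suc i
... | yes refl | _
  rewrite collapse-suc j
        | collapse-other {i} {suc j} (<⇒≢ (m≤n⇒m≤1+n 2+i≤j) ∘ sym)
        | collapse-suc j = collapse-other (<⇒≢ 2+i≤j ∘ sym)
... | no k≢ | yes refl
  rewrite collapse-other k≢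
        | collapse-suc i = sym (collapse-other (<⇒≢ (≤-trans (n≤1+n _) (m≤n⇒m≤1+n 2+i≤j))))
... | no k≢ | no k≢′
  rewrite collapse-other k≢ | collapse-other k≢′ = sym (collapse-other k≢)

collapse-absorbʳ : ∀ i k → collapse i (collapse (suc i) (collapse i k)) ≡ collapse i (collapse (suc i) k)
collapse-absorbʳ i k with k ≟ suc i
... | no  k≢   rewrite collapse-other k≢ = refl
... | yes refl
  rewrite collapse-suc i
        | collapse-other {suc i} {suc i} (<⇒≢ (n<1+n _))
        | collapse-suc i
        | collapse-other {suc i} {i} (<⇒≢ (≤-trans (n<1+n i) (n≤1+n _))) = collapse-other (<⇒≢ (n<1+n i))

collapse-≢ : ∀ i k → collapse i k ≢ suc i
collapse-≢ i k with k ≟ suc i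
... | yes refl rewrite collapse-suc i = <⇒≢ (n<1+n i)
... | no  k≢   rewrite collapse-other k≢ = k≢

-- The inner `collapse (suc i)` removes the value `i + 2`, and `collapse i` cannot bring it back, so
-- the outer map has nothing to move.
collapse-absorbˡ : ∀ i k → collapse (suc i) (collapse i (collapse (suc i) k)) ≡ collapse i (collapse (suc i) k)
collapse-absorbˡ i k = collapse-other (stays (collapse (suc i) k) (collapse-≢ (suc i) k))
  where
  stays : ∀ m → m ≢ suc (suc i) → collapse i m ≢ suc (suc i)
  stays m m≢ with m ≟ suc i
  ... | yes refl rewrite collapse-suc i = <⇒≢ (≤-trans (n<1+n i) (n≤1+n _))
  ... | no  m≢′  rewrite collapse-other m≢′ = m≢

far : ∀ {a b} → a ≤ b → 2 ≤ ∣ a - b ∣ → 2 + a ≤ b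
far a≤b 2≤ = m≤o∸n⇒m+n≤o 2 a≤b (subst (2 ≤_) (m≤n⇒∣m-n∣≡n∸m a≤b) 2≤)

HeckeRelation-act : ∀ {n} {u v : Word n} → HeckeRelation n u v → act u ≗ act v
HeckeRelation-act (idem i) k = collapse-idem (toℕ i) k
HeckeRelation-act (comm i j 2≤) k with ≤-total (toℕ i) (toℕ j)
... | inj₁ i≤j = collapse-comm (toℕ i) (toℕ j) k (far i≤j 2≤)
... | inj₂ j≤i = sym (collapse-comm (toℕ j) (toℕ i) k
  (far j≤i (subst (2 ≤_) (∣-∣-comm (toℕ i) (toℕ j)) 2≤)))
HeckeRelation-act (braid i j j≡1+i) k rewrite j≡1+i =
  trans (collapse-absorbʳ (toℕ i) k) (sym (collapse-absorbˡ (toℕ i) k))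

act-++-cong : ∀ {n} (u u′ v v′ : Word n) → act u ≗ act u′ → act v ≗ act v′ →
              act (u ++ v) ≗ act (u′ ++ v′)
act-++-cong u u′ v v′ e e′ k = trans (act-++ u v k)
  (trans (cong (act u) (e′ k)) (trans (e (act v′ k)) (sym (act-++ u′ v′ k))))

H₀-act : ∀ {n} {u v : Word n} → Monoid._≈_ (H₀ n) u v → act u ≗ act v
H₀-act (rel r)      k = HeckeRelation-act r k
H₀-act (equal refl) k = refl
H₀-act (symm p)     k = sym (H₀-act p k)
H₀-act (tran p q)   k = trans (H₀-act p k) (H₀-act q k)
H₀-act (∙-cong {x} {x′} {y} {y′} p q) k = act-++-cong x x′ y y′ (H₀-act p) (H₀-act q) k

M-act : ∀ {n} {u v : Word n} → Monoid._≈_ (M n) u v → act u ≗ act v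
M-act (rel (ndpf i j j≡1+i)) k rewrite j≡1+i = collapse-absorbʳ (toℕ i) k
M-act (equal p)  k = H₀-act p k
M-act (symm p)   k = sym (M-act p k)
M-act (tran p q) k = trans (M-act p k) (M-act q k)
M-act (∙-cong {x} {x′} {y} {y′} p q) k = act-++-cong x x′ y y′ (M-act p) (M-act q) k

-- The junk value [] for indices ≥ n satisfies all the relations as well.
letter : ∀ n → ℕ → Word n
letter n i with i <? n
... | yes i<n = fromℕ< i<n ∷ []
... | no  _   = []

letter-toℕ : ∀ {n} (i : Fin n) → letter n (toℕ i) ≡ i ∷ []
letter-toℕ {n} i with toℕ i <? n
... | yes i<n = cong (_∷ []) (Finₚ.fromℕ<-toℕ i i<n)
... | no  i≮n = ⊥-elim (i≮n (Finₚ.toℕ<n i))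

letter-generators : ∀ n → Generators (M n) (letter n)
letter-generators n = record
  { idempotent = idempotent
  ; commute    = commute
  ; absorbˡ    = absorbˡ
  ; absorbʳ    = absorbʳ
  }
  where
  open Monoid (M n) using (_∙_) renaming (_≈_ to _∼_; refl to ∼-refl; identityʳ to ∼-identityʳ)

  idempotent : ∀ i → letter n i ∙ letter n i ∼ letter n i
  idempotent i with i <? n
  ... | yes i<n = equal (rel (idem _))
  ... | no  _   = ∼-refl

  commute : ∀ i j → 2 + i ≤ j → letter n i ∙ letter n j ∼ letter n j ∙ letter n i
  commute i j 2+i≤j with i <? n | j <? n
  ... | yes i<n | yes j<n = equal (rel (comm _ _ (subst₂ (λ a b → 2 ≤ ∣ a - b ∣)
    (sym (Finₚ.toℕ-fromℕ< i<n)) (sym (Finₚ.toℕ-fromℕ< j<n))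
    (subst (2 ≤_) (sym (m≤n⇒∣m-n∣≡n∸m (m+n≤o⇒n≤o 2 2+i≤j))) (m+n≤o⇒m≤o∸n 2 2+i≤j)))))
  ... | yes _ | no _ = ∼-refl
  ... | no _  | yes _ = ∼-refl
  ... | no _  | no _  = ∼-refl

  consecutive : ∀ {i} (i<n : i < n) (1+i<n : suc i < n) →
                toℕ (fromℕ< 1+i<n) ≡ suc (toℕ (fromℕ< i<n))
  consecutive i<n 1+i<n = trans (Finₚ.toℕ-fromℕ< 1+i<n) (cong suc (sym (Finₚ.toℕ-fromℕ< i<n)))

  absorbʳ : ∀ i → letter n i ∙ (letter n (suc i) ∙ letter n i) ∼ letter n i ∙ letter n (suc i)
  absorbʳ i with i <? n | suc i <? n
  ... | yes i<n | yes 1+i<n = rel (ndpf _ _ (consecutive i<n 1+i<n))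
  ... | yes _   | no _      = equal (rel (idem _))
  ... | no i≮n  | yes 1+i<n = ⊥-elim (i≮n (<-trans (n<1+n i) 1+i<n))
  ... | no _    | no _      = ∼-refl

  absorbˡ : ∀ i → letter n (suc i) ∙ (letter n i ∙ letter n (suc i)) ∼ letter n i ∙ letter n (suc i)
  absorbˡ i with i <? n | suc i <? n
  ... | yes i<n | yes 1+i<n =
    tran (equal (symm (rel (braid _ _ (consecutive i<n 1+i<n))))) (rel (ndpf _ _ (consecutive i<n 1+i<n)))
  ... | yes _   | no _      = ∼-refl
  ... | no i≮n  | yes 1+i<n = ⊥-elim (i≮n (<-trans (n<1+n i) 1+i<n))
  ... | no _    | no _      = ∼-refl

module _ {n : ℕ} where
  open Monoid (M n) using () renaming (_≈_ to _∼_)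
  open NormalForm (M n) (letter n) (letter-generators n) using (nf; nf-id; nf-cong; nf-collapse)

  word∼nf : ∀ u → u ∼ nf n (act u)
  word∼nf []      = symm (nf-id n)
  word∼nf (i ∷ u) = tran (∙-cong (equal (equal (sym (letter-toℕ i)))) (word∼nf u))
    (nf-collapse n (toℕ i) (act-NDPF u) (Finₚ.toℕ<n i))

  -- Each word equals the normal form of its action, and `nf n` depends only on the values at
  -- arguments up to `n`.
  act-faithful : ∀ u v → (∀ k → k ≤ n → act u k ≡ act v k) → u ∼ v
  act-faithful u v e = tran (word∼nf u) (tran (nf-cong n e) (symm (word∼nf v)))

-- Transpositions and the exchange condition

-- Case analysis on a transposition, phrased for a relation `P` between a point and its image, so
-- that hypotheses about either can be put into `P`.
transpose-elim : ∀ {N p} {i j : Fin N} (P : Fin N → Fin N → Set p) → P i j → P j i →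
                 (∀ k → k ≢ i → k ≢ j → P k k) → ∀ k → P k (transpose i j k)
transpose-elim {i = i} {j} P pi pj p k with k Fin.≟ i
... | yes refl = pi
... | no  k≢i with k Fin.≟ j
...   | yes refl = pj
...   | no  k≢j  = p k k≢i k≢j

transpose-i : ∀ {N} (i j : Fin N) → transpose i j i ≡ j
transpose-i i j = transpose-elim (λ k l → k ≡ i → l ≡ j)
  (λ _ → refl) sym (λ k k≢i _ e → ⊥-elim (k≢i e)) i refl

transpose-j : ∀ {N} (i j : Fin N) → transpose i j j ≡ i
transpose-j i j = transpose-elim (λ k l → k ≡ j → l ≡ i) sym
  (λ _ → refl) (λ k _ k≢j e → ⊥-elim (k≢j e)) j refl

transpose-other : ∀ {N} {i j k : Fin N} → k ≢ i → k ≢ j → transpose i j k ≡ k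
transpose-other {i = i} {j} {k} = transpose-elim (λ k l → k ≢ i → k ≢ j → l ≡ k)
  (λ ≢ _ → ⊥-elim (≢ refl)) (λ _ ≢ → ⊥-elim (≢ refl)) (λ _ _ _ _ _ → refl) k

transpose-comm : ∀ {N} (i j k : Fin N) → transpose i j k ≡ transpose j i k
transpose-comm i j = transpose-elim (λ k l → l ≡ transpose j i k)
  (sym (transpose-j j i)) (sym (transpose-i j i)) (λ k k≢i k≢j → sym (transpose-other k≢j k≢i))

transpose-involutive : ∀ {N} (i j k : Fin N) → transpose i j (transpose i j k) ≡ k
transpose-involutive i j k =
  trans (cong (transpose i j) (transpose-comm i j k)) (transpose-inverse i j)

transpose-image : ∀ {N N′} {f : Fin N → Fin N′} → Injective _≡_ _≡_ f → ∀ i j k →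
                  transpose (f i) (f j) (f k) ≡ f (transpose i j k)
transpose-image {f = f} inj i j = transpose-elim (λ k l → transpose (f i) (f j) (f k) ≡ f l)
  (transpose-i (f i) (f j)) (transpose-j (f i) (f j))
  (λ k k≢i k≢j → transpose-other (k≢i ∘ inj) (k≢j ∘ inj))

perm : ∀ {n} → Word n → Fin (suc n) → Fin (suc n)
perm u = product u ⟨$⟩ʳ_

⟨$⟩ʳ-injective : ∀ {N} (π : Permutation′ N) → Injective _≡_ _≡_ (π ⟨$⟩ʳ_)
⟨$⟩ʳ-injective π e = trans (sym (inverseˡ π)) (trans (cong (π ⟨$⟩ˡ_) e) (inverseˡ π))

-- Exchanging two values amounts to exchanging the positions `p` and `q` that hold them: left
-- multiplication by `s i` becomes right multiplication by a transposition.
perm-∷ : ∀ {n} (i : Fin n) u {p q} → perm u p ≡ inject₁ i → perm u q ≡ Fin.suc i →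
         perm (i ∷ u) ≗ perm u ∘ transpose p q
perm-∷ i u {p} {q} wp wq k =
  subst₂ (λ a b → transpose a b (perm u k) ≡ perm u (transpose p q k)) wp wq
    (transpose-image (⟨$⟩ʳ-injective (product u)) p q k)

inject₁<suc : ∀ {n} (i : Fin n) → inject₁ i Fin.< Fin.suc i
inject₁<suc i = s≤s (≤-reflexive (Finₚ.toℕ-inject₁ i))

-- The values exchanged by `s i` are adjacent, so theirs is the only pair whose order changes.
s-reflects-< : ∀ {n} (i : Fin n) x y → (s i ⟨$⟩ʳ y) Fin.< (s i ⟨$⟩ʳ x) →
               y Fin.< x ⊎ (x ≡ inject₁ i × y ≡ Fin.suc i)
s-reflects-< i x y = transpose-elim
  (λ x sx → (s i ⟨$⟩ʳ y) Fin.< sx → y Fin.< x ⊎ (x ≡ inject₁ i × y ≡ Fin.suc i))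
  (transpose-elim
    (λ y sy → sy Fin.< Fin.suc i → y Fin.< inject₁ i ⊎ (inject₁ i ≡ inject₁ i × y ≡ Fin.suc i))
    (λ lt → ⊥-elim (<-irrefl refl lt))
    (λ _ → inj₂ (refl , refl))
    (λ y y≢ _ lt → inj₁ (≤∧≢⇒<
      (subst (toℕ y ≤_) (sym (Finₚ.toℕ-inject₁ i)) (s≤s⁻¹ lt)) (y≢ ∘ Finₚ.toℕ-injective)))
    y)
  (λ lt → inj₁ (transpose-elim (λ y sy → sy Fin.< inject₁ i → y Fin.< Fin.suc i)
    (λ _ → inject₁<suc i)
    (λ lt → ⊥-elim (<-irrefl refl lt))
    (λ y _ _ lt → m≤n⇒m≤1+n (subst (toℕ y <_) (Finₚ.toℕ-inject₁ i) lt))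
    y lt))
  (λ x x≢ x≢′ lt → inj₁ (transpose-elim (λ y sy → sy Fin.< x → y Fin.< x)
    (λ lt → subst (_< toℕ x) (sym (Finₚ.toℕ-inject₁ i)) (≤-trans (n≤1+n _) lt))
    (λ lt → ≤∧≢⇒< (subst (_< toℕ x) (Finₚ.toℕ-inject₁ i) lt) (x≢′ ∘ sym ∘ Finₚ.toℕ-injective))
    (λ _ _ _ lt → lt)
    y lt))
  x

-- The strong exchange condition. The identity has no inversion, so some letter of `u` first inverts
-- the values at `p` and `q`, and it does so by swapping exactly these two. Deleting that letter
-- composes the permutation with `transpose p q`.
exchange : ∀ {n} (u : Word n) {p q} → p Fin.< q → perm u q Fin.< perm u p →
           ∃ λ v → suc (length v) ≡ length u × perm v ≗ perm u ∘ transpose p q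
exchange []      p<q q<p = ⊥-elim (<-asym p<q q<p)
exchange (i ∷ u) {p} {q} p<q lt with s-reflects-< i (perm u p) (perm u q) lt
... | inj₁ lt′ =
  let (v , |v| , v≗) = exchange u p<q lt′
  in i ∷ v , cong suc |v| , λ k → cong (s i ⟨$⟩ʳ_) (v≗ k)
... | inj₂ (wp , wq) = u , refl , λ k →
  trans (cong (perm u) (sym (transpose-involutive p q k))) (sym (perm-∷ i u wp wq (transpose p q k)))

-- Reduced words

-- Reducedness in inductive form: each prepended letter creates a new inversion, because the value
-- `i` stands to the left of `i + 1` before the swap.
data Reduced {n} : Word n → Set where
  []   : Reduced []
  step : ∀ {i u p q} → Reduced u → p Fin.< q →
         perm u p ≡ inject₁ i → perm u q ≡ Fin.suc i → Reduced (i ∷ u)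

Shorter : ∀ {n} → Word n → Set
Shorter u = ∃ λ v → length v < length u × perm v ≗ perm u

reduced⊎shorter : ∀ {n} (u : Word n) → Reduced u ⊎ Shorter u
reduced⊎shorter []      = inj₁ []
reduced⊎shorter (i ∷ u) with reduced⊎shorter u
... | inj₂ (v , v<u , v≗) = inj₂ (i ∷ v , s≤s v<u , λ k → cong (s i ⟨$⟩ʳ_) (v≗ k))
... | inj₁ r with Finₚ.<-cmp p q | inverseʳ (product u) {inject₁ i} | inverseʳ (product u) {Fin.suc i}
  where
  p = product u ⟨$⟩ˡ inject₁ i
  q = product u ⟨$⟩ˡ Fin.suc i
...   | tri< p<q _ _ | wp | wq = inj₁ (step r p<q wp wq)
...   | tri≈ _ p≡q _ | wp | wq =
  ⊥-elim (Finₚ.<⇒≢ (inject₁<suc i) (trans (sym wp) (trans (cong (perm u) p≡q) wq)))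
-- The letter `i` undoes an inversion of `u`, so deleting a letter of `u` already gives the
-- permutation of `i ∷ u`, with two letters fewer.
...   | tri> _ _ q<p | wp | wq =
  let (v , |v| , v≗) = exchange u q<p (subst₂ Fin._<_ (sym wp) (sym wq) (inject₁<suc i))
  in inj₂ (v , m≤n⇒m≤1+n (≤-reflexive |v|) , λ k → trans (v≗ k)
       (sym (trans (perm-∷ i u wp wq k) (cong (perm u) (transpose-comm _ _ k)))))

reduce : ∀ {n} (u : Word n) → Acc _<_ (length u) →
         ∃ λ v → Reduced v × length v ≤ length u × perm v ≗ perm u
reduce u (acc rs) with reduced⊎shorter u
... | inj₁ r              = u , r , ≤-refl , λ _ → refl
... | inj₂ (v , v<u , v≗) =
  let (v′ , r , v′≤v , v′≗) = reduce v (rs v<u)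
  in v′ , r , ≤-trans v′≤v (<⇒≤ v<u) , λ k → trans (v′≗ k) (v≗ k)

-- The last inversion created, at `p` and `q`, is also present in the competitor `v`. Exchange
-- removes one letter from `v` and leaves a competitor for the tail `u`.
reduced-minimal : ∀ {n} {u : Word n} → Reduced u → ∀ v → perm v ≗ perm u → length u ≤ length v
reduced-minimal []       v e = z≤n
reduced-minimal (step {i} {u} {p} {q} r p<q wp wq) v e =
  let (v′ , |v′| , v′≗) = exchange v p<q (subst₂ Fin._<_
        (sym (at q p (transpose-j p q) wp)) (sym (at p q (transpose-i p q) wq)) (inject₁<suc i))
  in subst (suc (length u) ≤_) |v′| (s≤s (reduced-minimal r v′ λ k →
       trans (v′≗ k) (trans (e _) (trans (perm-∷ i u wp wq _) (cong (perm u) (transpose-involutive p q k))))))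
  where
  at : ∀ k l {x} → transpose p q k ≡ l → perm u l ≡ x → perm v k ≡ x
  at k l tk ul = trans (e k) (trans (perm-∷ i u wp wq k) (trans (cong (perm u) tk) ul))

Reduced⇒IsReducedWord : ∀ {n} {u : Word n} {w} → Reduced u → product u ≈ w → IsReducedWord w u
Reduced⇒IsReducedWord r e = e , λ v e′ → reduced-minimal r v (λ k → trans (e′ k) (sym (e k)))

IsReducedWord⇒Reduced : ∀ {n} {u : Word n} {w} → IsReducedWord w u → Reduced u
IsReducedWord⇒Reduced {u = u} (e , min) with reduced⊎shorter u
... | inj₁ r              = r
... | inj₂ (v , v<u , v≗) = ⊥-elim (<⇒≱ v<u (min v (λ k → trans (v≗ k) (e k))))

-- Suffix minima

record SuffixMin {N} (w : Fin N → Fin N) (j : Fin N) (m : ℕ) : Set where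
  field
    lower    : ∀ r → j Fin.≤ r → m ≤ toℕ (w r)
    position : Fin N
    after    : j Fin.≤ position
    attained : toℕ (w position) ≡ m

SuffixMin-≗ : ∀ {N} {w w′ : Fin N → Fin N} {j m} → w ≗ w′ → SuffixMin w j m → SuffixMin w′ j m
SuffixMin-≗ {m = m} e S = record
  { lower    = λ r j≤r → subst (λ x → m ≤ toℕ x) (e r) (lower r j≤r)
  ; position = position
  ; after    = after
  ; attained = trans (cong toℕ (sym (e position))) attained
  }
  where open SuffixMin S

SuffixMin-unique : ∀ {N} {w : Fin N → Fin N} {j m m′} → SuffixMin w j m → SuffixMin w j m′ → m ≡ m′
SuffixMin-unique {m = m} {m′} S S′ = ≤-antisym
  (subst (m ≤_) (attained S′) (lower S (position S′) (after S′)))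
  (subst (m′ ≤_) (attained S) (lower S′ (position S) (after S)))
  where open SuffixMin

-- Prepending `i` swaps the values `i` and `i + 1`. A suffix with minimum `i + 1` drops to `i`. A
-- suffix with minimum `i` keeps it, since reducedness puts `i + 1` to the right of `i` and hence in
-- the same suffix. All other minima are unaffected.
act-suffixMin : ∀ {n} {u : Word n} → Reduced u → ∀ j → SuffixMin (perm u) j (act u (toℕ j))
act-suffixMin [] j = record
  { lower    = λ _ j≤r → j≤r
  ; position = j
  ; after    = ≤-refl
  ; attained = refl
  }
act-suffixMin (step {i} {u} {p} {q} r p<q wp wq) j = go (act u (toℕ j)) (act-suffixMin r j)
  where
  w = perm u
  lowered : toℕ (s i ⟨$⟩ʳ Fin.suc i) ≡ toℕ i
  lowered = trans (cong toℕ (transpose-j (inject₁ i) (Fin.suc i))) (Finₚ.toℕ-inject₁ i)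
  go : ∀ m → SuffixMin w j m → SuffixMin (perm (i ∷ u)) j (collapse (toℕ i) m)
  go m record { lower = lower ; position = position ; after = after ; attained = attained }
    with m ≟ suc (toℕ i) | m ≟ toℕ i
  ... | yes refl | _ rewrite collapse-suc (toℕ i) = record
    { lower    = λ r j≤r → transpose-elim (λ x sx → suc (toℕ i) ≤ toℕ x → toℕ i ≤ toℕ sx)
        (λ _ → n≤1+n _) (λ _ → ≤-reflexive (sym (Finₚ.toℕ-inject₁ i))) (λ _ _ _ → <⇒≤)
        (w r) (lower r j≤r)
    ; position = position
    ; after    = after
    ; attained = trans (cong (λ x → toℕ (s i ⟨$⟩ʳ x)) (Finₚ.toℕ-injective {j = Fin.suc i} attained)) lowered
    }
  ... | no m≢ | m≟i rewrite collapse-other m≢ = record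
    { lower    = λ r j≤r → transpose-elim (λ x sx → m ≤ toℕ x → m ≤ toℕ sx)
        (λ m≤i → m≤n⇒m≤1+n (subst (m ≤_) (Finₚ.toℕ-inject₁ i) m≤i))
        (λ m≤1+i → subst (m ≤_) (sym (Finₚ.toℕ-inject₁ i)) (s≤s⁻¹ (≤∧≢⇒< m≤1+i m≢)))
        (λ _ _ _ m≤ → m≤) (w r) (lower r j≤r)
    ; position = proj₁ (moved m≟i)
    ; after    = proj₁ (proj₂ (moved m≟i))
    ; attained = proj₂ (proj₂ (moved m≟i))
    }
    where
    moved : Dec (m ≡ toℕ i) → ∃ λ r → j Fin.≤ r × toℕ (s i ⟨$⟩ʳ w r) ≡ m
    moved (yes refl) = q , ≤-trans (subst (j Fin.≤_) pos≡p after) (<⇒≤ p<q) ,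
      trans (cong (λ x → toℕ (s i ⟨$⟩ʳ x)) wq) lowered
      where
      pos≡p : position ≡ p
      pos≡p = ⟨$⟩ʳ-injective (product u)
        (trans (Finₚ.toℕ-injective (trans attained (sym (Finₚ.toℕ-inject₁ i)))) (sym wp))
    moved (no m≢i) = position , after , trans (cong toℕ (transpose-other
      (λ e → m≢i (trans (sym attained) (trans (cong toℕ e) (Finₚ.toℕ-inject₁ i))))
      (λ e → m≢ (trans (sym attained) (cong toℕ e))))) attained

-- A smaller value follows each of `p` and `q`, so neither position attains a suffix minimum, and
-- the minimum survives their exchange.
SuffixMin-swap : ∀ {N} {w : Fin N → Fin N} {p q d} → p Fin.< q → q Fin.< d →
                 w q Fin.< w p → w d Fin.< w q →
                 ∀ {j m} → SuffixMin w j m → SuffixMin (w ∘ transpose p q) j m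
SuffixMin-swap {w = w} {p} {q} {d} p<q q<d wq<wp wd<wq {j} {m} S = record
  { lower    = λ r → transpose-elim (λ r r′ → j Fin.≤ r → m ≤ toℕ (w r′))
      (λ j≤p → lower q (≤-trans j≤p (<⇒≤ p<q)))
      -- Position `p` may lie outside the suffix, so the bound on `w p`, now at `q`, comes from the
      -- smaller value at `d`.
      (λ j≤q → ≤-trans (lower d (≤-trans j≤q (<⇒≤ q<d))) (<⇒≤ (<-trans wd<wq wq<wp)))
      (λ r _ _ j≤r → lower r j≤r)
      r
  ; position = position
  ; after    = after
  ; attained = trans (cong (toℕ ∘ w) (transpose-other position≢p position≢q)) attained
  }
  where
  open SuffixMin S
  exceeds : ∀ {e r} → r Fin.< e → w e Fin.< w r → position ≢ r
  exceeds {e} {r} r<e we<wr refl = <⇒≱ we<wr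
    (subst (_≤ toℕ (w e)) (sym attained) (lower e (≤-trans after (<⇒≤ r<e))))
  position≢p : position ≢ p
  position≢p = exceeds p<q wq<wp
  position≢q : position ≢ q
  position≢q = exceeds q<d wd<wq

-- Conjugation by the longest permutation

-- Since both positions and values are reversed, suffix minima of `conj w` encode prefix maxima of
-- `w`.
conj : ∀ {N} → (Fin N → Fin N) → Fin N → Fin N
conj w = opposite ∘ w ∘ opposite

opposite-anti-< : ∀ {N} {i j : Fin N} → i Fin.< j → opposite j Fin.< opposite i
opposite-anti-< {i = i} {j} i<j = subst₂ _<_ (sym (Finₚ.opposite-prop j)) (sym (Finₚ.opposite-prop i))
  (∸-monoʳ-< (s≤s i<j) (Finₚ.toℕ<n j))

opposite-cancel-< : ∀ {N} {i j : Fin N} → opposite j Fin.< opposite i → i Fin.< j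
opposite-cancel-< {i = i} {j} lt =
  subst₂ Fin._<_ (Finₚ.opposite-involutive i) (Finₚ.opposite-involutive j) (opposite-anti-< lt)

opposite-injective : ∀ {N} → Injective _≡_ _≡_ (opposite {N})
opposite-injective {x = i} {j} e =
  trans (sym (Finₚ.opposite-involutive i)) (trans (cong opposite e) (Finₚ.opposite-involutive j))

opposite-inject₁ : ∀ {n} (i : Fin n) → opposite (inject₁ i) ≡ Fin.suc (opposite i)
opposite-inject₁ Fin.zero    = refl
opposite-inject₁ (Fin.suc i) = cong inject₁ (opposite-inject₁ i)

conj-opposite : ∀ {N} (w : Fin N → Fin N) k → conj w (opposite k) ≡ opposite (w k)
conj-opposite w k = cong (opposite ∘ w) (Finₚ.opposite-involutive k)

conj-injective : ∀ {N} {w : Fin N → Fin N} → Injective _≡_ _≡_ w → Injective _≡_ _≡_ (conj w)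
conj-injective inj = opposite-injective ∘ inj ∘ opposite-injective

-- Reversal carries the adjacent values `i`, `i + 1` to an adjacent pair in the opposite order, so
-- it conjugates `s i` to `s (opposite i)`.
perm-Ψ : ∀ {n} (u : Word n) → perm (Ψ u) ≗ conj (perm u)
perm-Ψ []      k = sym (Finₚ.opposite-involutive k)
perm-Ψ (i ∷ u) k =
  trans (cong (s (opposite i) ⟨$⟩ʳ_) (perm-Ψ u k))
  (trans (transpose-comm _ _ (opposite x))
  (trans (cong (λ y → transpose y (opposite (Fin.suc i)) (opposite x)) (sym (opposite-inject₁ i)))
         (transpose-image opposite-injective (inject₁ i) (Fin.suc i) x)))
  where x = perm u (opposite k)

perm-Ψ-opposite : ∀ {n} (u : Word n) k → perm (Ψ u) (opposite k) ≡ opposite (perm u k)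
perm-Ψ-opposite u k = trans (perm-Ψ u (opposite k)) (conj-opposite (perm u) k)

perm-Ψ-transpose : ∀ {n} {u x : Word n} {b c} → perm x ≗ perm u ∘ transpose b c →
                   perm (Ψ x) ≗ perm (Ψ u) ∘ transpose (opposite c) (opposite b)
perm-Ψ-transpose {u = u} {x} {b} {c} e k =
  trans (perm-Ψ x k)
  (trans (cong opposite (e (opposite k)))
  (trans (sym (perm-Ψ-opposite u _))
         (cong (perm (Ψ u))
           (trans (sym (transpose-image opposite-injective b c (opposite k)))
           (trans (cong (transpose _ _) (Finₚ.opposite-involutive k))
                  (transpose-comm (opposite b) (opposite c) k))))))

Reduced-Ψ : ∀ {n} {u : Word n} → Reduced u → Reduced (Ψ u)
Reduced-Ψ []                       = []
Reduced-Ψ (step {i} {u} {p} {q} r p<q wp wq) = step (Reduced-Ψ r) (opposite-anti-< p<q)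
  (trans (perm-Ψ-opposite u q) (cong opposite wq))
  (trans (perm-Ψ-opposite u p) (trans (cong opposite wp) (opposite-inject₁ i)))

-- Fibers of ω

-- For permutations given by reduced words this is equality of the words in `M n`. It mentions only
-- the permutations, so it can be used independently of the words chosen.
SameSuffixMin : ∀ {N} (w w′ : Fin N → Fin N) → Set
SameSuffixMin w w′ = ∀ j → ∃ λ m → SuffixMin w j m × SuffixMin w′ j m

SameSuffixMin-≗ : ∀ {N} {v v′ w w′ : Fin N → Fin N} → v ≗ v′ → w ≗ w′ →
                  SameSuffixMin v w → SameSuffixMin v′ w′
SameSuffixMin-≗ e e′ same j =
  let (m , S , S′) = same j in m , SuffixMin-≗ e S , SuffixMin-≗ e′ S′

module _ {n : ℕ} {u v : Word n} (r : Reduced u) (r′ : Reduced v) where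
  open Monoid (M n) using () renaming (_≈_ to _∼_)

  ∼⇒sameSuffixMin : u ∼ v → SameSuffixMin (perm u) (perm v)
  ∼⇒sameSuffixMin u∼v j = act u (toℕ j) , act-suffixMin r j ,
    subst (SuffixMin (perm v) j) (sym (M-act u∼v (toℕ j))) (act-suffixMin r′ j)

  sameSuffixMin⇒∼ : SameSuffixMin (perm u) (perm v) → u ∼ v
  sameSuffixMin⇒∼ same = act-faithful u v λ k k≤n →
    subst (λ k → act u k ≡ act v k) (Finₚ.toℕ-fromℕ< (s≤s k≤n)) (at (fromℕ< (s≤s k≤n)))
    where
    at : ∀ j → act u (toℕ j) ≡ act v (toℕ j)
    at j = let (m , S , S′) = same j in
      trans (SuffixMin-unique (act-suffixMin r j) S) (SuffixMin-unique S′ (act-suffixMin r′ j))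

-- Uniqueness of the avoiding permutation

-- In `w` the value `w′ q` stands before `q`, so it is not the minimum of the suffix from `q`. The
-- common minimum is therefore smaller than `w′ q`, and `w′` attains it after `q`.
smaller-later : ∀ {N} {w w′ : Fin N → Fin N} → SameSuffixMin w w′ → Injective _≡_ _≡_ w →
                ∀ {p q} → p Fin.< q → w p ≡ w′ q → ∃ λ d → q Fin.< d × w′ d Fin.< w′ q
smaller-later {w = w} {w′} same inj {p} {q} p<q wp≡w′q with same q
... | m , S , S′ = S′.position , ≤∧≢⇒< S′.after q≢d , subst (_< toℕ (w′ q)) (sym S′.attained) m<w′q
  where
  module S  = SuffixMin S
  module S′ = SuffixMin S′
  m≢w′q : m ≢ toℕ (w′ q)
  m≢w′q m≡ = <⇒≱ p<q (subst (q Fin.≤_)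
    (inj (Finₚ.toℕ-injective (trans S.attained (trans m≡ (cong toℕ (sym wp≡w′q)))))) S.after)
  m<w′q : m < toℕ (w′ q)
  m<w′q = ≤∧≢⇒< (S′.lower q ≤-refl) m≢w′q
  q≢d : toℕ q ≢ toℕ S′.position
  q≢d e = m≢w′q (trans (sym S′.attained) (cong (toℕ ∘ w′) (sym (Finₚ.toℕ-injective e))))

-- Before `p` the two maps agree, so by injectivity the value `f p` cannot be taken there by `g`.
later-position : ∀ {N} {f g : Fin N → Fin N} → Injective _≡_ _≡_ f → ∀ {p q} →
                 (∀ {k} → k Fin.< p → f k ≡ g k) → f p ≢ g p → g q ≡ f p → p Fin.< q
later-position inj {p} {q} agree ≢ e with Finₚ.<-cmp p q
... | tri< p<q _ _ = p<q
... | tri≈ _ refl _ = ⊥-elim (≢ (sym e))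
... | tri> _ q≢p q<p = ⊥-elim (q≢p (inj (sym (trans (agree q<p) e))))

Contains4321 : ∀ {N} → Permutation′ N → Set
Contains4321 w = ∃ λ a → ∃ λ b → ∃ λ c → ∃ λ d →
  (a Fin.< b × b Fin.< c × c Fin.< d) ×
  ((w ⟨$⟩ʳ d) Fin.< (w ⟨$⟩ʳ c) × (w ⟨$⟩ʳ c) Fin.< (w ⟨$⟩ʳ b) × (w ⟨$⟩ʳ b) Fin.< (w ⟨$⟩ʳ a))

contains4321? : ∀ {N} (w : Permutation′ N) → Dec (Contains4321 w)
contains4321? w = Finₚ.any? λ a → Finₚ.any? λ b → Finₚ.any? λ c → Finₚ.any? λ d →
  (a Finₚ.<? b ×-dec b Finₚ.<? c ×-dec c Finₚ.<? d) ×-dec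
  ((w ⟨$⟩ʳ d) Finₚ.<? (w ⟨$⟩ʳ c) ×-dec (w ⟨$⟩ʳ c) Finₚ.<? (w ⟨$⟩ʳ b) ×-dec
   (w ⟨$⟩ʳ b) Finₚ.<? (w ⟨$⟩ʳ a))

-- In `ρ` the value `g p` plays the 3, and `f p`, which `g` takes later at `q`, plays the 2. The
-- suffix minima supply the 1 at `d`, the prefix maxima the 4.
first-difference : ∀ {N} (π ρ : Permutation′ N) → let f = π ⟨$⟩ʳ_ ; g = ρ ⟨$⟩ʳ_ in
                   SameSuffixMin f g → SameSuffixMin (conj f) (conj g) →
                   ∀ p → (∀ {k} → k Fin.< p → f k ≡ g k) → f p Fin.< g p → Contains4321 ρ
first-difference π ρ same same′ p agree fp<gp =
  let (d , q<d , gd<gq) = smaller-later same (⟨$⟩ʳ-injective π) p<q (sym gq)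
      -- The map `f` takes the value `g p` only at `r`, after `p`. In the conjugates this order is
      -- reversed, and the smaller later value found there is a larger earlier value of `g`.
      (a , p<a , ga<gp) = smaller-later same′ (conj-injective (⟨$⟩ʳ-injective π)) (opposite-anti-< p<r)
        (trans (conj-opposite f r) (trans (cong opposite fr) (sym (conj-opposite g p))))
  in opposite a , p , q , d ,
     (opposite-cancel-< (subst (opposite p Fin.<_) (sym (Finₚ.opposite-involutive a)) p<a) , p<q , q<d) ,
     (gd<gq , subst (Fin._< g p) (sym gq) fp<gp ,
      opposite-cancel-< (subst (conj g a Fin.<_) (conj-opposite g p) ga<gp))
  where
  f = π ⟨$⟩ʳ_
  g = ρ ⟨$⟩ʳ_
  q = ρ ⟨$⟩ˡ f p
  r = π ⟨$⟩ˡ g p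
  gq : g q ≡ f p
  gq = inverseʳ ρ
  fr : f r ≡ g p
  fr = inverseʳ π
  p<q : p Fin.< q
  p<q = later-position (⟨$⟩ʳ-injective π) agree (Finₚ.<⇒≢ fp<gp) gq
  p<r : p Fin.< r
  p<r = later-position (⟨$⟩ʳ-injective ρ) (sym ∘ agree) (Finₚ.<⇒≢ fp<gp ∘ sym) fr

avoiding-unique : ∀ {N} (π ρ : Permutation′ N) → let f = π ⟨$⟩ʳ_ ; g = ρ ⟨$⟩ʳ_ in
                  SameSuffixMin f g → SameSuffixMin (conj f) (conj g) →
                  Avoids4321 π → Avoids4321 ρ → π ≈ ρ
avoiding-unique π ρ same same′ πav ρav p = go p (Fin-<-wellFounded p)
  where
  flip-same : ∀ {w w′} → SameSuffixMin w w′ → SameSuffixMin w′ w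
  flip-same same j = let (m , S , S′) = same j in m , S′ , S
  go : ∀ p → Acc Fin._<_ p → π ⟨$⟩ʳ p ≡ ρ ⟨$⟩ʳ p
  go p (acc rs) with Finₚ.<-cmp (π ⟨$⟩ʳ p) (ρ ⟨$⟩ʳ p)
  ... | tri≈ _ e _  = e
  ... | tri< lt _ _ = ⊥-elim (ρav (first-difference π ρ same same′ p (λ {k} k<p → go k (rs k<p)) lt))
  ... | tri> _ _ gt = ⊥-elim (πav (first-difference ρ π (flip-same same) (flip-same same′) p
                                    (λ {k} k<p → sym (go k (rs k<p))) gt))

-- Existence of an avoiding permutation

module _ {n : ℕ} where
  open Monoid (M n) using () renaming (_≈_ to _∼_; refl to ∼-refl)

  -- Exchanging the 3 and the 2 of a pattern shortens the word, so the process ends. The 1 at `d`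
  -- protects the suffix minima; the 4 at `a` does the same for the conjugate.
  avoiding-exists : ∀ (u : Word n) → Reduced u → Acc _<_ (length u) →
                    ∃ λ v → Reduced v × v ∼ u × Ψ v ∼ Ψ u × Avoids4321 (product v)
  avoiding-exists u r (acc rs) with contains4321? (product u)
  ... | no av = u , r , ∼-refl , ∼-refl , av
  ... | yes (a , b , c , d , (a<b , b<c , c<d) , (wd<wc , wc<wb , wb<wa)) =
    let (v , |v| , v≗)         = exchange u b<c wc<wb
        -- Deleting a letter may leave a word that is not reduced, while `act` is known to give
        -- suffix minima only for reduced words.
        (x , rx , x≤v , x≗)    = reduce v (<-wellFounded _)
        (y , ry , y∼x , Ψ∼ , av) = avoiding-exists x rx (rs (≤-trans (s≤s x≤v) (≤-reflexive |v|)))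
        x≗w∘t : perm x ≗ perm u ∘ transpose b c
        x≗w∘t k = trans (x≗ k) (v≗ k)
        x∼u : x ∼ u
        x∼u = symm (sameSuffixMin⇒∼ r rx λ j → act u (toℕ j) , act-suffixMin r j ,
          SuffixMin-≗ (sym ∘ x≗w∘t) (SuffixMin-swap b<c c<d wc<wb wd<wc (act-suffixMin r j)))
        Ψx∼Ψu : Ψ x ∼ Ψ u
        Ψx∼Ψu = symm (sameSuffixMin⇒∼ (Reduced-Ψ r) (Reduced-Ψ rx) λ j →
          act (Ψ u) (toℕ j) , act-suffixMin (Reduced-Ψ r) j ,
          SuffixMin-≗ (sym ∘ perm-Ψ-transpose {u = u} {x} x≗w∘t)
            -- Conjugation reads the pattern backwards: `opposite c`, `opposite b`, `opposite a`
            -- take the places of `b`, `c`, `d`.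
            (SuffixMin-swap (opposite-anti-< b<c) (opposite-anti-< a<b)
              (Ψ-< wc<wb) (Ψ-< wb<wa) (act-suffixMin (Reduced-Ψ r) j)))
    in y , ry , tran y∼x x∼u , tran Ψ∼ Ψx∼Ψu , av
    where
    Ψ-< : ∀ {k l} → perm u k Fin.< perm u l → perm (Ψ u) (opposite l) Fin.< perm (Ψ u) (opposite k)
    Ψ-< {k} {l} lt = subst₂ Fin._<_ (sym (perm-Ψ-opposite u l)) (sym (perm-Ψ-opposite u k)) (opposite-anti-< lt)

  -- The representative `x` can be replaced by the reduced word `u`, since they are equal in `H₀ n`
  -- and both `φ` and `Ψ` respect this equality.
  InFiber⇒reduced : ∀ c w → InFiber {n} c w →
                    ∃ λ u → Reduced u × product u ≈ w × u ∼ proj₁ c × Ψ u ∼ proj₂ c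
  InFiber⇒reduced c w (x , (u , red , x≈u) , (x∼ , Ψx∼)) =
    u , IsReducedWord⇒Reduced {w = w} red , proj₁ red ,
    tran (equal (symm x≈u)) x∼ , tran (equal (symm (Ψ-cong x≈u))) Ψx∼
    where Ψ-cong = MonoidMorphisms.IsMonoidIsomorphism.⟦⟧-cong (Ψ-isMonoidIsomorphism {n})

mainTheorem3 : (n : ℕ) (c : Monoid.Carrier (M n ×ᴹ M n)) →
    (∃ λ (w : Permutation′ (suc n)) → InFiber c w) →
    ∃! _≈_ (λ (w : Permutation′ (suc n)) → InFiber c w × Avoids4321 w)
mainTheorem3 n c (w , w∈c) =
  let (u , r , _ , u∼ , Ψu∼)     = InFiber⇒reduced c w w∈c
      (v , r′ , v∼u , Ψ∼ , av)   = avoiding-exists u r (<-wellFounded _)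
      v∼ = tran v∼u u∼
      Ψv∼ = tran Ψ∼ Ψu∼
  in product v ,
     ((v , (v , Reduced⇒IsReducedWord {w = product v} r′ (λ _ → refl) , equal refl) , (v∼ , Ψv∼)) , av) ,
     λ {w′} (w′∈c , av′) →
       let (u′ , r″ , e , u′∼ , Ψu′∼) = InFiber⇒reduced c w′ w′∈c
       in avoiding-unique (product v) w′
            (SameSuffixMin-≗ (λ _ → refl) e (∼⇒sameSuffixMin r′ r″ (tran v∼ (symm u′∼))))
            (SameSuffixMin-≗ (perm-Ψ v) (λ k → trans (perm-Ψ u′ k) (cong opposite (e (opposite k))))
              (∼⇒sameSuffixMin (Reduced-Ψ r′) (Reduced-Ψ r″) (tran Ψv∼ (symm Ψu′∼))))
            av av′
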